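{- Algorithm Division-MHE is a $1/2$-approximation algorithm for the MHE problem. That is, it runs in polynomial time and, on every instance, outputs a total vertex coloring extending the given partial coloring whose number of happy edges is at least $\frac12\cdot OPT$, where $OPT$ is the maximum number of happy edges over all total colorings extending the given partial coloring.
   Context: Maximum Happy Edges problem (MHE): an instance consists of an undirected graph $G=(V,E)$, a color set $C=\{1,2,\ldots,k\}$ ($k$ is part of the input), and a partial vertex coloring $c\colon V\to C$ (i.e. $c$ assigns colors to only part of the vertices). A total vertex coloring $c'\colon V\to C$ extends $c$ if it agrees with $c$ wherever $c$ is defined. Under a total coloring, an edge is happy if its two endpoints have the same color, and unhappy otherwise. The task is to find a total coloring extending $c$ that maximizes the number of happy edges. Algorithm Division-MHE is formulated for graphs with nonnegative edge weights $w(e)$ (MHE is the case where all weights equal $1$). It computes two total colorings of $G$ extending $c$ and outputs the better one (the one with larger total weight of happy edges). First coloring: let $E'$ be the set of edges having exactly one endpoint not colored by $c$, and let $G'=(V,E')$. For each uncolored vertex $v$ that has a neighbor colored by $c$, consider the star in $G'$ centered at $v$ (all edges of $E'$ incident to $v$), and color $v$ with a color in $\{c(u) : u\in N(v),\ u \text{ colored by } c\}$ that maximizes the total weight of happy edges in this star. Then color all vertices still uncolored with one arbitrary color. Second coloring: color all vertices left uncolored by $c$ with one arbitrary color. -}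

module Defs where

open import Data.Bool using (Bool; true; false; if_then_else_; _xor_)
open import Data.Fin using (Fin; _≟_)
import Data.Fin as Fin
open import Data.List using (List; []; _∷_; length; filter; filterᵇ; foldr; map; allFin)
open import Data.List.Membership.Propositional using (_∈_)
open import Data.List.Relation.Unary.All using (All; []; _∷_)
import Data.List.Relation.Unary.All as All
open import Data.List.Relation.Unary.Any using (here; there)
open import Data.List.Relation.Unary.Unique.Propositional using (Unique)
open import Data.Maybe using (Maybe; just; nothing; maybe′; is-nothing)
open import Data.Maybe.Properties using (≡-dec)
open import Data.Nat using (ℕ; suc; _+_; _≤_; _<_; _≤ᵇ_)
open import Data.Nat.ListAction using (sum)
open import Data.Product using (∃; ∃-syntax; _×_; _,_; proj₁; proj₂)
open import Data.Sum using (_⊎_)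
open import Data.Vec using (Vec; lookup; tabulate; _[_]≔_)
open import Relation.Binary.PropositionalEquality using (_≡_; refl)
open import Relation.Nullary using (¬_; Dec; does)
open import Relation.Nullary.Decidable using (_⊎-dec_)

------------------------------------------------------------------------
-- Maximum Happy Edges

-- A finite simple undirected graph on the vertices Fin n.  The edge {u , v}
-- is represented by the one ordered pair (u , v) with u < v.
record Graph (n : ℕ) : Set where
  field
    edges  : List (Fin n × Fin n)
    normal : All (λ (u , v) → u Fin.< v) edges
    unique : Unique edges

-- The colours {1, …, k} are Fin k, and a partial colouring maps the vertices
-- on which it is undefined to nothing.
record Instance : Set where
  field
    n k   : ℕ
    k>0   : 0 < k
    graph : Graph n
    c     : Vec (Maybe (Fin k)) n
  open Graph graph public

module _ (I : Instance) where
  open Instance I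

  Vertex Colour Edge Colouring : Set
  Vertex    = Fin n
  Colour    = Fin k
  Edge      = Vertex × Vertex
  Colouring = Vec Colour n

  Extends : Colouring → Set
  Extends c′ = ∀ v d → lookup c v ≡ just d → lookup c′ v ≡ d

  happyEdges : Colouring → List Edge
  happyEdges c′ = filter (λ (u , v) → lookup c′ u ≟ lookup c′ v) edges

  happy : Colouring → ℕ
  happy c′ = length (happyEdges c′)

  IsOPT : ℕ → Set
  IsOPT opt = (∃[ c′ ] Extends c′ × happy c′ ≡ opt)
            × (∀ c′ → Extends c′ → happy c′ ≤ opt)

  ----------------------------------------------------------------------
  -- Division-MHE on unit weights, with its choices (ties between best
  -- colours, the arbitrary colours) left open: a relation between instances
  -- and possible outputs.

  Uncoloured : Vertex → Set
  Uncoloured v = lookup c v ≡ nothing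

  Adjacent : Vertex → Vertex → Set
  Adjacent u v = (u , v) ∈ edges ⊎ (v , u) ∈ edges

  -- d ∈ { c(u) : u ∈ N(v), u coloured by c }
  Candidate : Vertex → Colour → Set
  Candidate v d = ∃[ u ] Adjacent u v × lookup c u ≡ just d

  -- Edges with exactly one endpoint not coloured by c.
  E′ : List Edge
  E′ = filterᵇ (λ (u , v) → is-nothing (lookup c u) xor is-nothing (lookup c v)) edges

  star : Vertex → List Edge
  star v = filter (λ (x , y) → (x ≟ v) ⊎-dec (y ≟ v)) E′

  -- The number of happy edges of the star when its centre v gets colour d.
  -- For uncoloured v, both endpoints of every edge in the star are coloured
  -- by c [ v ]≔ just d, so no edge is counted because of nothing ≡ nothing.
  starHappy : Vertex → Colour → ℕ
  starHappy v d = length (filter (λ (x , y) → ≡-dec _≟_ (lookup cᵥ x) (lookup cᵥ y)) (star v))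
    where
    cᵥ : Vec (Maybe Colour) n
    cᵥ = c [ v ]≔ just d

  record FirstColouring (c₁ : Colouring) : Set where
    field
      extends   : Extends c₁
      candidate : ∀ v → Uncoloured v → ∃ (Candidate v) → Candidate v (lookup c₁ v)
      maximal   : ∀ v → Uncoloured v → ∀ d → Candidate v d →
                  starHappy v d ≤ starHappy v (lookup c₁ v)
      remaining : ∃[ a ] (∀ v → Uncoloured v → ¬ ∃ (Candidate v) → lookup c₁ v ≡ a)

  record SecondColouring (c₂ : Colouring) : Set where
    field
      extends   : Extends c₂
      remaining : ∃[ a ] (∀ v → Uncoloured v → lookup c₂ v ≡ a)

  Output : Colouring → Set
  Output c′ = ∃[ c₁ ] ∃[ c₂ ]
    FirstColouring c₁ × SecondColouring c₂ ×
    (c′ ≡ c₁ ⊎ c′ ≡ c₂) × happy c₁ ≤ happy c′ × happy c₂ ≤ happy c′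

  -- k is left out, so a bound polynomial in this size holds however k is
  -- encoded (unary or binary).
  size : ℕ
  size = n + length edges

------------------------------------------------------------------------
-- A first-order programming language with unit-cost semantics.
--
-- Vertices and colours are opaque: they can only be copied and tested for
-- equality.  Arrays are indexed by the vertices.  Every syntactic operation
-- costs one step each time it is executed, plus the cost of the operands it
-- evaluates; loops also pay one step per iteration.

infixr 6 _⊗_

data Ty : Set where
  nat bool vertex colour : Ty
  option list array      : Ty → Ty
  _⊗_                    : Ty → Ty → Ty

Ctx : Set
Ctx = List Ty

-- Variables are membership proofs; #0 is the innermost bound variable.
pattern #0 = here refl
pattern #1 = there #0
pattern #2 = there #1
pattern #3 = there #2
pattern #4 = there #3
pattern #5 = there #4

data Term (Γ : Ctx) : Ty → Set where
  var       : ∀ {A} → A ∈ Γ → Term Γ A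
  let-in    : ∀ {A B} → Term Γ A → Term (A ∷ Γ) B → Term Γ B
  ze        : Term Γ nat
  su        : Term Γ nat → Term Γ nat
  leq       : Term Γ nat → Term Γ nat → Term Γ bool
  eqVertex  : Term Γ vertex → Term Γ vertex → Term Γ bool
  eqColour  : Term Γ colour → Term Γ colour → Term Γ bool
  ifte      : ∀ {A} → Term Γ bool → Term Γ A → Term Γ A → Term Γ A
  none      : ∀ {A} → Term Γ (option A)
  some      : ∀ {A} → Term Γ A → Term Γ (option A)
  caseOpt   : ∀ {A B} → Term Γ (option A) → Term Γ B → Term (A ∷ Γ) B → Term Γ B
  fst       : ∀ {A B} → Term Γ (A ⊗ B) → Term Γ A
  snd       : ∀ {A B} → Term Γ (A ⊗ B) → Term Γ B
  nil       : ∀ {A} → Term Γ (list A)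
  cons      : ∀ {A} → Term Γ A → Term Γ (list A) → Term Γ (list A)
  -- The loop body binds the current element (#0) and the accumulator (#1).
  fold      : ∀ {A B} → Term Γ (list A) → Term Γ B → Term (A ∷ B ∷ Γ) B → Term Γ B
  at        : ∀ {A} → Term Γ (array A) → Term Γ vertex → Term Γ A
  forVertex : ∀ {A} → Term (vertex ∷ Γ) A → Term Γ (array A)

module Semantics (n k : ℕ) where

  ⟦_⟧ : Ty → Set
  ⟦ nat ⟧      = ℕ
  ⟦ bool ⟧     = Bool
  ⟦ vertex ⟧   = Fin n
  ⟦ colour ⟧   = Fin k
  ⟦ option A ⟧ = Maybe ⟦ A ⟧
  ⟦ list A ⟧   = List ⟦ A ⟧
  ⟦ array A ⟧  = Vec ⟦ A ⟧ n
  ⟦ A ⊗ B ⟧    = ⟦ A ⟧ × ⟦ B ⟧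

  Env : Ctx → Set
  Env Γ = All ⟦_⟧ Γ

  value : ∀ {Γ A} → Term Γ A → Env Γ → ⟦ A ⟧
  value (var x)         ρ = All.lookup ρ x
  value (let-in s t)    ρ = value t (value s ρ ∷ ρ)
  value ze              ρ = 0
  value (su t)          ρ = suc (value t ρ)
  value (leq s t)       ρ = value s ρ ≤ᵇ value t ρ
  value (eqVertex s t)  ρ = does (value s ρ ≟ value t ρ)
  value (eqColour s t)  ρ = does (value s ρ ≟ value t ρ)
  value (ifte b s t)    ρ = if value b ρ then value s ρ else value t ρ
  value none            ρ = nothing
  value (some t)        ρ = just (value t ρ)
  value (caseOpt o s t) ρ = maybe′ (λ x → value t (x ∷ ρ)) (value s ρ) (value o ρ)
  value (fst t)         ρ = proj₁ (value t ρ)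
  value (snd t)         ρ = proj₂ (value t ρ)
  value nil             ρ = []
  value (cons s t)      ρ = value s ρ ∷ value t ρ
  value (fold l z s)    ρ = foldr (λ x acc → value s (x ∷ acc ∷ ρ)) (value z ρ) (value l ρ)
  value (at a v)        ρ = lookup (value a ρ) (value v ρ)
  value (forVertex t)   ρ = tabulate (λ v → value t (v ∷ ρ))

  foldTime : {A B : Set} → (A → B → B) → (A → B → ℕ) → B → List A → ℕ
  foldTime f cost z []       = 0
  foldTime f cost z (x ∷ xs) = foldTime f cost z xs + suc (cost x (foldr f z xs))

  time : ∀ {Γ A} → Term Γ A → Env Γ → ℕ
  time (var x)         ρ = 1
  time (let-in s t)    ρ = 1 + time s ρ + time t (value s ρ ∷ ρ)
  time ze              ρ = 1
  time (su t)          ρ = 1 + time t ρ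
  time (leq s t)       ρ = 1 + time s ρ + time t ρ
  time (eqVertex s t)  ρ = 1 + time s ρ + time t ρ
  time (eqColour s t)  ρ = 1 + time s ρ + time t ρ
  time (ifte b s t)    ρ = 1 + time b ρ + (if value b ρ then time s ρ else time t ρ)
  time none            ρ = 1
  time (some t)        ρ = 1 + time t ρ
  time (caseOpt o s t) ρ = 1 + time o ρ + maybe′ (λ x → time t (x ∷ ρ)) (time s ρ) (value o ρ)
  time (fst t)         ρ = 1 + time t ρ
  time (snd t)         ρ = 1 + time t ρ
  time nil             ρ = 1
  time (cons s t)      ρ = 1 + time s ρ + time t ρ
  time (fold l z s)    ρ = 1 + time l ρ + time z ρ +
                           foldTime (λ x acc → value s (x ∷ acc ∷ ρ))
                                    (λ x acc → time s (x ∷ acc ∷ ρ))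
                                    (value z ρ) (value l ρ)
  time (at a v)        ρ = 1 + time a ρ + time v ρ
  time (forVertex t)   ρ = 1 + sum (map (λ v → suc (time t (v ∷ ρ))) (allFin n))

------------------------------------------------------------------------
-- Division-MHE as a program of this language

edge : Ty
edge = vertex ⊗ vertex

countHappy : ∀ {Γ} → list edge ∈ Γ → array colour ∈ Γ → Term Γ nat
countHappy es c′ =
  fold (var es) ze
    (ifte (eqColour (at (var (there (there c′))) (fst (var #0)))
                    (at (var (there (there c′))) (snd (var #0))))
      (su (var #1))
      (var #1))

-- The colours of the coloured neighbours of v, with multiplicity; for
-- uncoloured v these are the leaves of the star centred at v.
leafColours : ∀ {Γ} → list edge ∈ Γ → array (option colour) ∈ Γ → vertex ∈ Γ →
              Term Γ (list colour)
leafColours es c v =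
  fold (var es) nil
    (ifte (eqVertex (fst (var #0)) (var (there (there v))))
      (caseOpt (at (var (there (there c))) (snd (var #0)))
        (var #1)
        (cons (var #0) (var #2)))
      (ifte (eqVertex (snd (var #0)) (var (there (there v))))
        (caseOpt (at (var (there (there c))) (fst (var #0)))
          (var #1)
          (cons (var #0) (var #2)))
        (var #1)))

count : ∀ {Γ} → colour ∈ Γ → list colour ∈ Γ → Term Γ nat
count d ds =
  fold (var ds) ze
    (ifte (eqColour (var #0) (var (there (there d)))) (su (var #1)) (var #1))

-- A most frequent element of a list of colours, if the list is nonempty.
mostFrequent : ∀ {Γ} → list colour ∈ Γ → Term Γ (option colour)
mostFrequent ds =
  fold (var ds) none
    (caseOpt (var #1)
      (some (var #0))
      -- #0 is the best colour so far, #1 the current one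
      (ifte (leq (count #1 (there (there (there ds)))) (count #0 (there (there (there ds)))))
        (some (var #0))
        (some (var #1))))

-- The inputs are the edges, the partial colouring and the two arbitrary
-- colours a and b used by the first and the second colouring.
Inputs : Ctx
Inputs = list edge ∷ array (option colour) ∷ colour ∷ colour ∷ []

firstColouring : Term Inputs (array colour)
firstColouring =
  forVertex
    (caseOpt (at (var #2) (var #0))
      (let-in (leafColours #1 #2 #0)
        (caseOpt (mostFrequent #0)
          (var #4)
          (var #0)))
      (var #0))

-- Placed under the binder of the first colouring.
secondColouring : Term (array colour ∷ Inputs) (array colour)
secondColouring =
  forVertex
    (caseOpt (at (var #3) (var #0))
      (var #5)
      (var #0))

divisionMHE : Term Inputs (array colour)
divisionMHE =
  let-in firstColouring
    (let-in secondColouring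
      (ifte (leq (countHappy #2 #0) (countHappy #2 #1))
        (var #1)
        (var #0)))

module _ (I : Instance) (a b : Colour I) where
  open Instance I
  open Semantics n k

  input : Env Inputs
  input = edges ∷ c ∷ a ∷ b ∷ []

  run : Colouring I
  run = value divisionMHE input

  runningTime : ℕ
  runningTime = time divisionMHE input

{-# OPTIONS --safe #-}

-- Let c* be optimal.  An edge that is happy under c* either has both ends
-- coloured by c or both ends uncoloured, and is then happy under the second
-- colouring, or it is a happy spoke: it joins an uncoloured centre v to a
-- vertex with c-colour c*(v).  In each star the first colouring makes at least
-- as many spokes happy as c* does, and distinct stars share no edge, so the
-- happy spokes of c* number at most the happy edges of the first colouring.
-- Hence OPT ≤ happy c₂ + happy c₁, at most twice the better of the two.
module Submission where

open import Defs
open import Data.Bool using (true; false; if_then_else_; T; T?; _xor_)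
open import Data.Empty using (⊥-elim)
open import Data.Fin using (Fin; _≟_; punchIn)
import Data.Fin as Fin
open import Data.Fin.Properties using (punchInᵢ≢i; any?)
import Data.Fin.Properties as Finₚ
open import Data.List using (List; []; _∷_; length; filter; foldr; map; allFin; cartesianProductWith)
open import Data.List.Membership.Propositional using (_∈_; find; lose)
open import Data.List.Membership.Propositional.Properties using (∈-allFin; ∈-cartesianProductWith⁺)
open import Data.List.Properties using (filter-some; length-tabulate)
open import Data.List.Relation.Unary.All using (All; []; _∷_)
import Data.List.Relation.Unary.All as All
open import Data.List.Relation.Unary.Any using (Any; here; there)
import Data.List.Relation.Unary.Any as Any
open import Data.Maybe using (Maybe; just; nothing; maybe′; fromMaybe; is-nothing)
open import Data.Maybe.Properties using (≡-dec)
open import Data.Nat using (ℕ; zero; suc; _+_; _*_; _^_; _≤_; _<_; _≤ᵇ_; z≤n; s≤s)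
open import Data.Nat.ListAction using () renaming (sum to sumᴸ)
open import Data.Nat.Properties hiding (_≟_)
open import Data.List.Extrema ≤-totalOrder using (argmax; f[xs]≤f[argmax])
open import Data.Product using (∃; ∃-syntax; _×_; _,_; proj₁; proj₂)
open import Data.Sum using (_⊎_; inj₁; inj₂; [_,_]′)
open import Data.Vec using (Vec; []; _∷_; lookup; tabulate; _[_]≔_)
open import Data.Vec.Functional using (removeAt)
open import Data.Vec.Properties
  using (lookup∘tabulate; tabulate∘lookup; tabulate-cong; lookup∘update; lookup∘update′)
open import Function using (_∘_; id; _⇔_; mk⇔)
open import Relation.Binary.PropositionalEquality
open import Relation.Nullary using (¬_; Dec; yes; no; does; contradiction)
open import Relation.Nullary.Decidable using (_×-dec_; _⊎-dec_; does-⇔; dec-true; dec-false)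
open import Relation.Unary using (Decidable)
open import Algebra.Properties.CommutativeMonoid.Sum +-0-commutativeMonoid
  using (sum; sum-cong-≗; sum-remove; ∑-distrib-+)

-- Counting

-- Branching on `does` alone lets this reduce in step with `filter`, and makes it depend only on the
-- truth value of the decision.
𝟙 : {P : Set} → Dec P → ℕ
𝟙 P? = if does P? then 1 else 0

𝟙-mono : {P Q : Set} (P? : Dec P) (Q? : Dec Q) → (P → Q) → 𝟙 P? ≤ 𝟙 Q?
𝟙-mono (no _)  _       _   = z≤n
𝟙-mono (yes _) (yes _) _   = ≤-refl
𝟙-mono (yes p) (no ¬q) p⇒q = contradiction (p⇒q p) ¬q

𝟙-no : {P : Set} (P? : Dec P) → ¬ P → 𝟙 P? ≡ 0
𝟙-no P? ¬p = cong (if_then 1 else 0) (dec-false P? ¬p)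

module _ {A : Set} where

  # : {P : A → Set} → Decidable P → List A → ℕ
  # P? xs = length (filter P? xs)

  #-∷ : {P : A → Set} (P? : Decidable P) (x : A) (xs : List A) →
        # P? (x ∷ xs) ≡ 𝟙 (P? x) + # P? xs
  #-∷ P? x xs with does (P? x)
  ... | true  = refl
  ... | false = refl

  -- The left side is the form to which the program's counting loops `count` and `countHappy`
  -- evaluate.
  #-foldr : {P : A → Set} (P? : Decidable P) (xs : List A) →
            foldr (λ x acc → if does (P? x) then suc acc else acc) 0 xs ≡ # P? xs
  #-foldr P? []       = refl
  #-foldr P? (x ∷ xs) with does (P? x)
  ... | true  = cong suc (#-foldr P? xs)
  ... | false = #-foldr P? xs

  #-filter : {P Q : A → Set} (P? : Decidable P) (Q? : Decidable Q) (xs : List A) →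
             # P? (filter Q? xs) ≡ # (λ x → Q? x ×-dec P? x) xs
  #-filter P? Q? []       = refl
  #-filter P? Q? (x ∷ xs) with does (Q? x)
  ... | false = #-filter P? Q? xs
  ... | true with does (P? x)
  ...   | true  = cong suc (#-filter P? Q? xs)
  ...   | false = #-filter P? Q? xs

  #-cong : {P Q : A → Set} (P? : Decidable P) (Q? : Decidable Q) {xs : List A} →
           All (λ x → P x ⇔ Q x) xs → # P? xs ≡ # Q? xs
  #-cong P? Q? []                     = refl
  #-cong P? Q? {x ∷ xs} (P⇔Q ∷ P⇔Qs) = begin
    # P? (x ∷ xs)           ≡⟨ #-∷ P? x xs ⟩
    𝟙 (P? x) + # P? xs      ≡⟨ cong₂ _+_ (cong (if_then 1 else 0) (does-⇔ P⇔Q (P? x) (Q? x))) (#-cong P? Q? P⇔Qs) ⟩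
    𝟙 (Q? x) + # Q? xs      ≡⟨ #-∷ Q? x xs ⟨
    # Q? (x ∷ xs)           ∎
    where open ≡-Reasoning

  0<#⇒Any : {P : A → Set} (P? : Decidable P) (xs : List A) → 0 < # P? xs → Any P xs
  0<#⇒Any P? (x ∷ xs) 0<# with P? x
  ... | yes p = here p
  ... | no  _ = there (0<#⇒Any P? xs 0<#)

-- Finite sums and counting over families of predicates

sum-mono : ∀ {n} {f g : Fin n → ℕ} → (∀ i → f i ≤ g i) → sum f ≤ sum g
sum-mono {zero}  f≤g = z≤n
sum-mono {suc n} f≤g = +-mono-≤ (f≤g Fin.zero) (sum-mono (f≤g ∘ Fin.suc))

sum-zero : ∀ {n} {f : Fin n → ℕ} → (∀ i → f i ≡ 0) → sum f ≡ 0
sum-zero {zero}  f≡0 = refl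
sum-zero {suc n} f≡0 = cong₂ _+_ (f≡0 Fin.zero) (sum-zero (f≡0 ∘ Fin.suc))

term≤sum : ∀ {n} (f : Fin n → ℕ) i → f i ≤ sum f
term≤sum f Fin.zero    = m≤m+n _ _
term≤sum f (Fin.suc i) = ≤-trans (term≤sum (f ∘ Fin.suc) i) (m≤n+m _ _)

𝟙-yes : {P : Set} (P? : Dec P) → P → 𝟙 P? ≡ 1
𝟙-yes P? p = cong (if_then 1 else 0) (dec-true P? p)

𝟙-union : ∀ {n} {P Q : Set} {R : Fin n → Set} (P? : Dec P) (Q? : Dec Q) (R? : Decidable R) →
          (P → Q ⊎ ∃ R) → 𝟙 P? ≤ 𝟙 Q? + sum (𝟙 ∘ R?)
𝟙-union (no _)  Q? R? cover = z≤n
𝟙-union (yes p) Q? R? cover with cover p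
... | inj₁ q       = m≤n⇒m≤n+o _ (≤-reflexive (sym (𝟙-yes Q? q)))
... | inj₂ (i , r) = m≤n⇒m≤o+n _ (≤-trans (≤-reflexive (sym (𝟙-yes (R? i) r))) (term≤sum _ i))

-- At most one `R i` holds. If one does, its term is split off the sum and the others vanish by
-- uniqueness; if none does, the whole sum vanishes.
𝟙-disjoint : ∀ {n} {P : Set} {R : Fin n → Set} (P? : Dec P) (R? : Decidable R) →
             (∀ i → R i → P) → (∀ i j → R i → R j → i ≡ j) → sum (𝟙 ∘ R?) ≤ 𝟙 P?
𝟙-disjoint {zero}  P? R? _ _ = z≤n
𝟙-disjoint {suc n} P? R? R⇒P unique with any? R?
... | no ¬∃R      = ≤-trans (≤-reflexive (sum-zero (λ i → 𝟙-no (R? i) (λ r → ¬∃R (i , r))))) z≤n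
... | yes (i , r) = begin
  sum (𝟙 ∘ R?)                             ≡⟨ sum-remove (𝟙 ∘ R?) ⟩
  𝟙 (R? i) + sum (removeAt (𝟙 ∘ R?) i)      ≡⟨ cong (𝟙 (R? i) +_) (sum-zero others) ⟩
  𝟙 (R? i) + 0                             ≡⟨ +-identityʳ _ ⟩
  𝟙 (R? i)                                 ≤⟨ 𝟙-mono (R? i) P? (R⇒P i) ⟩
  𝟙 P?                                     ∎
  where
  open ≤-Reasoning
  others : ∀ j → 𝟙 (R? (punchIn i j)) ≡ 0
  others j = 𝟙-no (R? (punchIn i j)) (λ r′ → punchInᵢ≢i i j (unique _ _ r′ r))

sum-#-∷ : ∀ {A : Set} {n} {R : Fin n → A → Set} (R? : ∀ i → Decidable (R i)) x xs →
          sum (λ i → # (R? i) (x ∷ xs)) ≡ sum (λ i → 𝟙 (R? i x)) + sum (λ i → # (R? i) xs)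
sum-#-∷ R? x xs = trans (sum-cong-≗ (λ i → #-∷ (R? i) x xs))
                        (∑-distrib-+ (λ i → 𝟙 (R? i x)) (λ i → # (R? i) xs))

module _ {A : Set} {n : ℕ} {P : A → Set} {R : Fin n → A → Set}
         (P? : Decidable P) (R? : ∀ i → Decidable (R i)) where

  -- A union bound: each element counted on the left is charged to `Q` or to some member of the
  -- family. It serves to split the happy edges of an optimal colouring.
  #-union : {Q : A → Set} (Q? : Decidable Q) {xs : List A} →
            All (λ x → P x → Q x ⊎ (∃[ i ] R i x)) xs →
            # P? xs ≤ # Q? xs + sum (λ i → # (R? i) xs)
  #-union Q? []                       = z≤n
  #-union Q? {x ∷ xs} (cover ∷ covers) = begin
    # P? (x ∷ xs)
      ≡⟨ #-∷ P? x xs ⟩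
    𝟙 (P? x) + # P? xs
      ≤⟨ +-mono-≤ (𝟙-union (P? x) (Q? x) (λ i → R? i x) cover) (#-union Q? covers) ⟩
    (𝟙 (Q? x) + sum (λ i → 𝟙 (R? i x))) + (# Q? xs + sum (λ i → # (R? i) xs))
      ≡⟨ +-interchange (𝟙 (Q? x)) _ _ _ ⟩
    (𝟙 (Q? x) + # Q? xs) + (sum (λ i → 𝟙 (R? i x)) + sum (λ i → # (R? i) xs))
      ≡⟨ cong₂ _+_ (#-∷ Q? x xs) (sum-#-∷ R? x xs) ⟨
    # Q? (x ∷ xs) + sum (λ i → # (R? i) (x ∷ xs))
      ∎
    where
    open ≤-Reasoning
    open import Algebra.Properties.CommutativeSemigroup +-commutativeSemigroup
      using () renaming (interchange to +-interchange)

  -- The packing counterpart: no element is counted for two indices. Through it the disjointness of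
  -- the stars enters the proof.
  #-disjoint : {xs : List A} →
               All (λ x → (∀ i → R i x → P x) × (∀ i j → R i x → R j x → i ≡ j)) xs →
               sum (λ i → # (R? i) xs) ≤ # P? xs
  #-disjoint []                              = ≤-reflexive (sum-zero {n} (λ _ → refl))
  #-disjoint {x ∷ xs} ((R⇒P , unique) ∷ rest) = begin
    sum (λ i → # (R? i) (x ∷ xs))                          ≡⟨ sum-#-∷ R? x xs ⟩
    sum (λ i → 𝟙 (R? i x)) + sum (λ i → # (R? i) xs)       ≤⟨ +-mono-≤ (𝟙-disjoint (P? x) (λ i → R? i x) R⇒P unique) (#-disjoint rest) ⟩
    𝟙 (P? x) + # P? xs                                     ≡⟨ #-∷ P? x xs ⟨
    # P? (x ∷ xs)                                          ∎
    where open ≤-Reasoning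

-- Spokes and stars

module _ {n k : ℕ} (c : Vec (Maybe (Fin k)) n) where

  -- An edge is stored as one ordered pair, so the centre `v` may be either component. That the
  -- centre is uncoloured is left to `HappySpoke`.
  Spoke : Fin n → Fin k → Fin n × Fin n → Set
  Spoke v d (x , y) = (x ≡ v × lookup c y ≡ just d) ⊎ (y ≡ v × lookup c x ≡ just d)

  spoke? : ∀ v d → Decidable (Spoke v d)
  spoke? v d (x , y) = ((x ≟ v) ×-dec ≡-dec _≟_ (lookup c y) (just d))
                ⊎-dec ((y ≟ v) ×-dec ≡-dec _≟_ (lookup c x) (just d))

  -- Shaped after the loop body of `leafColours`, so that the value of that program is `leaves` by
  -- computation.
  addLeaf : Fin n → Fin n × Fin n → List (Fin k) → List (Fin k)
  addLeaf v (x , y) ds =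
    if does (x ≟ v) then maybe′ (_∷ ds) ds (lookup c y) else
    if does (y ≟ v) then maybe′ (_∷ ds) ds (lookup c x) else ds

  leaves : Fin n → List (Fin n × Fin n) → List (Fin k)
  leaves v = foldr (addLeaf v) []

  #-addLeaf : ∀ v d x y → x ≢ y → ∀ ds →
              # (_≟ d) (addLeaf v (x , y) ds) ≡ 𝟙 (spoke? v d (x , y)) + # (_≟ d) ds
  #-addLeaf v d x y x≢y ds with x ≟ v | y ≟ v
  ... | yes x≡v | yes y≡v = contradiction (trans x≡v (sym y≡v)) x≢y
  ... | no _    | no _    = refl
  ... | yes _   | no _    with lookup c y
  ...   | nothing = refl
  ...   | just d′ with does (d′ ≟ d)
  ...     | true  = refl
  ...     | false = refl
  #-addLeaf v d x y x≢y ds | no _ | yes _ with lookup c x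
  ...   | nothing = refl
  ...   | just d′ with does (d′ ≟ d)
  ...     | true  = refl
  ...     | false = refl

  -- The bridge from the program to the stars: each edge adds a leaf of colour `d` exactly when it
  -- is a spoke of that colour, so frequencies in the leaf list are star counts.
  #-leaves : ∀ v d {es} → All (λ (x , y) → x ≢ y) es → # (_≟ d) (leaves v es) ≡ # (spoke? v d) es
  #-leaves v d []                              = refl
  #-leaves v d {(x , y) ∷ es} (x≢y ∷ loopless) = begin
    # (_≟ d) (leaves v ((x , y) ∷ es))                  ≡⟨ #-addLeaf v d x y x≢y (leaves v es) ⟩
    𝟙 (spoke? v d (x , y)) + # (_≟ d) (leaves v es)     ≡⟨ cong (𝟙 (spoke? v d (x , y)) +_) (#-leaves v d loopless) ⟩
    𝟙 (spoke? v d (x , y)) + # (spoke? v d) es          ≡⟨ #-∷ (spoke? v d) (x , y) es ⟨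
    # (spoke? v d) ((x , y) ∷ es)                       ∎
    where open ≡-Reasoning

  -- Each edge adds at most one leaf. This bounds the input length of `mostFrequent` in the running
  -- time.
  length-leaves : ∀ v es → length (leaves v es) ≤ length es
  length-leaves v []             = z≤n
  length-leaves v ((x , y) ∷ es) with does (x ≟ v) | does (y ≟ v)
  ... | false | false = m≤n⇒m≤1+n (length-leaves v es)
  ... | true  | _     with lookup c y
  ...   | nothing = m≤n⇒m≤1+n (length-leaves v es)
  ...   | just _  = s≤s (length-leaves v es)
  length-leaves v ((x , y) ∷ es) | false | true with lookup c x
  ...   | nothing = m≤n⇒m≤1+n (length-leaves v es)
  ...   | just _  = s≤s (length-leaves v es)

-- A most frequent element

module _ {A : Set} (f : A → ℕ) where

  -- The loop body of `mostFrequent`, with the multiplicity count abstracted to `f`.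
  pick : A → Maybe A → Maybe A
  pick x = maybe′ (λ m → if f x ≤ᵇ f m then just m else just x) (just x)

  IsMaximiser : List A → Maybe A → Set
  IsMaximiser xs nothing  = xs ≡ []
  IsMaximiser xs (just m) = m ∈ xs × All (λ x → f x ≤ f m) xs

  pick-maximises : ∀ xs → IsMaximiser xs (foldr pick nothing xs)
  pick-maximises []       = refl
  pick-maximises (x ∷ xs) with foldr pick nothing xs | pick-maximises xs
  ... | nothing | refl = here refl , ≤-refl ∷ []
  ... | just m  | m∈xs , max with f x ≤ᵇ f m in eq
  ...   | true  = there m∈xs , ≤ᵇ⇒≤ _ _ (subst T (sym eq) _) ∷ max
  -- The new element beats the old maximiser, hence by transitivity everything that the old one
  -- dominated.
  ...   | false = here refl , ≤-refl ∷ All.map (λ fy≤fm → ≤-trans fy≤fm fm≤fx) max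
    where
    fm≤fx : f m ≤ f x
    fm≤fx = ≰⇒≥ (λ fx≤fm → subst T eq (≤⇒≤ᵇ fx≤fm))

-- The optimum

allVecs : ∀ k n → List (Vec (Fin k) n)
allVecs k zero    = [] ∷ []
allVecs k (suc n) = cartesianProductWith _∷_ (allFin k) (allVecs k n)

∈-allVecs : ∀ {k n} (xs : Vec (Fin k) n) → xs ∈ allVecs k n
∈-allVecs []       = here refl
∈-allVecs (x ∷ xs) = ∈-cartesianProductWith⁺ _∷_ (∈-allFin x) (∈-allVecs xs)

module _ (I : Instance) where
  open Instance I

  -- A retraction of all total colourings onto the extensions of `c`. The search for an optimum can
  -- therefore range over all vectors.
  fill : Colouring I → Colouring I
  fill t = tabulate (λ v → fromMaybe (lookup t v) (lookup c v))

  fill-extends : ∀ t → Extends I (fill t)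
  fill-extends t v d cv≡d = trans (lookup∘tabulate _ v) (cong (fromMaybe (lookup t v)) cv≡d)

  fill-id : ∀ t → Extends I t → fill t ≡ t
  fill-id t t-extends = trans (tabulate-cong pointwise) (tabulate∘lookup t)
    where
    pointwise : ∀ v → fromMaybe (lookup t v) (lookup c v) ≡ lookup t v
    pointwise v with lookup c v in cv≡
    ... | nothing = refl
    ... | just d  = sym (t-extends v d cv≡)

  optimum : ∃ (IsOPT I)
  optimum = happy I (fill best) , (fill best , fill-extends best , refl) , maximal
    where
    base best : Colouring I
    -- `argmax` wants a default element; a colour exists because `k` is positive.
    base = tabulate (λ _ → Fin.fromℕ< k>0)
    best = argmax (happy I ∘ fill) base (allVecs k n)

    maximal : ∀ c′ → Extends I c′ → happy I c′ ≤ happy I (fill best)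
    maximal c′ c′-extends = subst (λ t → happy I t ≤ happy I (fill best)) (fill-id c′ c′-extends)
      (All.lookup (f[xs]≤f[argmax] base (allVecs k n)) (∈-allVecs c′))

-- Stars of uncoloured vertices

module _ (I : Instance) where
  open Instance I

  loopless : All (λ (x , y) → x ≢ y) edges
  loopless = All.map Finₚ.<⇒≢ normal

  -- Fusing the three filters leaves one condition per edge. Since `v` is uncoloured, an edge at `v`
  -- with exactly one uncoloured end becomes happy under the update precisely when its other end has
  -- `c`-colour `d`.
  starHappy≡#spoke : ∀ v d → Uncoloured I v → starHappy I v d ≡ # (spoke? c v d) edges
  starHappy≡#spoke v d cv≡nothing = begin
    starHappy I v d                                        ≡⟨ #-filter H? S? (E′ I) ⟩
    # (λ e → S? e ×-dec H? e) (E′ I)                       ≡⟨ #-filter (λ e → S? e ×-dec H? e) M? edges ⟩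
    # (λ e → M? e ×-dec (S? e ×-dec H? e)) edges           ≡⟨ #-cong _ (spoke? c v d) (All.map (λ {e} → equiv {e}) loopless) ⟩
    # (spoke? c v d) edges                                 ∎
    where
    open ≡-Reasoning
    cᵥ = c [ v ]≔ just d

    M? : Decidable {A = Edge I} (λ (x , y) → T (is-nothing (lookup c x) xor is-nothing (lookup c y)))
    M? (x , y) = T? (is-nothing (lookup c x) xor is-nothing (lookup c y))
    S? : Decidable {A = Edge I} (λ (x , y) → x ≡ v ⊎ y ≡ v)
    S? (x , y) = (x ≟ v) ⊎-dec (y ≟ v)
    H? : Decidable {A = Edge I} (λ (x , y) → lookup cᵥ x ≡ lookup cᵥ y)
    H? (x , y) = ≡-dec _≟_ (lookup cᵥ x) (lookup cᵥ y)

    centre : lookup cᵥ v ≡ just d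
    centre = lookup∘update v c (just d)

    other : ∀ {u} → u ≢ v → lookup cᵥ u ≡ lookup c u
    other u≢v = lookup∘update′ u≢v c (just d)

    equiv : ∀ {(x , y) : Edge I} → x ≢ y →
            (T (is-nothing (lookup c x) xor is-nothing (lookup c y)) ×
             (x ≡ v ⊎ y ≡ v) × lookup cᵥ x ≡ lookup cᵥ y) ⇔ Spoke c v d (x , y)
    equiv {x , y} x≢y = mk⇔ to from
      where
      to : _ → Spoke c v d (x , y)
      -- The graph has no loops, so the update at `v` leaves the other endpoint alone.
      to (_ , inj₁ refl , same) = inj₁ (refl , trans (sym (other (x≢y ∘ sym))) (trans (sym same) centre))
      to (_ , inj₂ refl , same) = inj₂ (refl , trans (sym (other x≢y)) (trans same centre))

      from : Spoke c v d (x , y) → _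
      from (inj₁ (refl , cy≡d)) =
        subst₂ (λ p q → T (is-nothing p xor is-nothing q)) (sym cv≡nothing) (sym cy≡d) _ ,
        inj₁ refl , trans centre (sym (trans (other (x≢y ∘ sym)) cy≡d))
      from (inj₂ (refl , cx≡d)) =
        subst₂ (λ p q → T (is-nothing p xor is-nothing q)) (sym cx≡d) (sym cv≡nothing) _ ,
        inj₂ refl , trans (trans (other x≢y) cx≡d) (sym centre)

  candidate⇒spoke : ∀ {v d} → Candidate I v d → Any (Spoke c v d) edges
  candidate⇒spoke (u , inj₁ uv∈E , cu≡d) = lose uv∈E (inj₂ (refl , cu≡d))
  candidate⇒spoke (u , inj₂ vu∈E , cu≡d) = lose vu∈E (inj₁ (refl , cu≡d))

  spoke⇒candidate : ∀ {v d} → Any (Spoke c v d) edges → Candidate I v d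
  spoke⇒candidate any with find any
  ... | (_ , u) , e∈E , inj₁ (refl , cu≡d) = u , inj₂ e∈E , cu≡d
  ... | (u , _) , e∈E , inj₂ (refl , cu≡d) = u , inj₁ e∈E , cu≡d

  -- Membership is read off from counts: a candidate yields a spoke, so the multiplicity of its
  -- colour among the leaves is positive.
  candidate⇒leaf : ∀ {v d} → Candidate I v d → d ∈ leaves c v edges
  candidate⇒leaf {v} {d} cand = Any.map sym (0<#⇒Any (_≟ d) (leaves c v edges)
    (subst (0 <_) (sym (#-leaves c v d loopless)) (filter-some (spoke? c v d) (candidate⇒spoke cand))))

  leaf⇒candidate : ∀ {v d} → d ∈ leaves c v edges → Candidate I v d
  leaf⇒candidate {v} {d} d∈ = spoke⇒candidate (0<#⇒Any (spoke? c v d) edges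
    (subst (0 <_) (#-leaves c v d loopless) (filter-some (_≟ d) (Any.map sym d∈))))

-- The approximation ratio

  happy? : (c′ : Colouring I) → Decidable {A = Edge I} (λ (x , y) → lookup c′ x ≡ lookup c′ y)
  happy? c′ (x , y) = lookup c′ x ≟ lookup c′ y

  -- The happy spokes of `c′` at centre `v`. With the centre uncoloured and the other end coloured
  -- by `c`, the edge determines its centre.
  HappySpoke : Colouring I → Vertex I → Edge I → Set
  HappySpoke c′ v e = Uncoloured I v × Spoke c v (lookup c′ v) e

  happySpoke? : ∀ c′ v → Decidable (HappySpoke c′ v)
  happySpoke? c′ v e = ≡-dec _≟_ (lookup c v) nothing ×-dec spoke? c v (lookup c′ v) e

  #happySpoke : Colouring I → Vertex I → ℕ
  #happySpoke c′ v = # (happySpoke? c′ v) edges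

  happy≤second+spokes : ∀ {c* c₂} → Extends I c* → SecondColouring I c₂ →
                        happy I c* ≤ happy I c₂ + sum (#happySpoke c*)
  happy≤second+spokes {c*} {c₂} ext* second =
    #-union (happy? c*) (happySpoke? c*) (happy? c₂) {edges} (All.tabulate (λ {e} _ → cover e))
    where
    module S = SecondColouring second

    cover : ∀ ((x , y) : Edge I) → lookup c* x ≡ lookup c* y →
            lookup c₂ x ≡ lookup c₂ y ⊎ (∃[ v ] HappySpoke c* v (x , y))
    cover (x , y) same = go (lookup c x) (lookup c y) refl refl
      where
      go : ∀ p q → lookup c x ≡ p → lookup c y ≡ q →
           lookup c₂ x ≡ lookup c₂ y ⊎ (∃[ v ] HappySpoke c* v (x , y))
      -- The second colouring gives both ends its one arbitrary colour.
      go nothing nothing cx≡ cy≡ = inj₁ (trans (proj₂ S.remaining x cx≡) (sym (proj₂ S.remaining y cy≡)))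
      -- The uncoloured end is the centre; happiness under `c*` gives it the colour that `c`
      -- prescribes for the other end.
      go nothing (just q) cx≡ cy≡ = inj₂ (x , cx≡ , inj₁ (refl , trans cy≡ (cong just (sym (trans same (ext* y q cy≡))))))
      go (just p) nothing cx≡ cy≡ = inj₂ (y , cy≡ , inj₂ (refl , trans cx≡ (cong just (trans (sym (ext* x p cx≡)) same))))
      -- Both colourings extend `c`, so they agree on both ends.
      go (just p) (just q) cx≡ cy≡ = inj₁ (begin
        lookup c₂ x ≡⟨ S.extends x p cx≡ ⟩
        p           ≡⟨ ext* x p cx≡ ⟨
        lookup c* x ≡⟨ same ⟩
        lookup c* y ≡⟨ ext* y q cy≡ ⟩
        q           ≡⟨ S.extends y q cy≡ ⟨
        lookup c₂ y ∎)
        where open ≡-Reasoning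

  -- A happy spoke is happy because an extension keeps the leaf's colour, and no edge is a happy
  -- spoke for two centres.
  spokes≤happy : ∀ {c₁} → Extends I c₁ → sum (#happySpoke c₁) ≤ happy I c₁
  spokes≤happy {c₁} ext = #-disjoint (happy? c₁) (happySpoke? c₁) {edges}
    (All.tabulate (λ {e} _ → sound e , centre-unique e))
    where
    sound : ∀ ((x , y) : Edge I) v → HappySpoke c₁ v (x , y) → lookup c₁ x ≡ lookup c₁ y
    sound (x , y) v (_ , inj₁ (refl , cy≡)) = sym (ext y _ cy≡)
    sound (x , y) v (_ , inj₂ (refl , cx≡)) = ext x _ cx≡

    clash : ∀ {v d} → lookup c v ≡ nothing → ¬ (lookup c v ≡ just d)
    clash cv≡nothing cv≡d with () ← trans (sym cv≡nothing) cv≡d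

    centre-unique : ∀ ((x , y) : Edge I) v w → HappySpoke c₁ v (x , y) → HappySpoke c₁ w (x , y) → v ≡ w
    centre-unique e v w (_  , inj₁ (refl , _))   (_  , inj₁ (refl , _))   = refl
    centre-unique e v w (_  , inj₂ (refl , _))   (_  , inj₂ (refl , _))   = refl
    -- Opposite ends cannot both be centres: the leaf seen from one centre is coloured by `c`, yet
    -- as the other centre it would be uncoloured.
    centre-unique e v w (_  , inj₁ (refl , cy≡)) (uw , inj₂ (refl , _))   = ⊥-elim (clash uw cy≡)
    centre-unique e v w (_  , inj₂ (refl , cx≡)) (uw , inj₁ (refl , _))   = ⊥-elim (clash uw cx≡)

  #happySpoke-uncoloured : ∀ c′ v → Uncoloured I v → #happySpoke c′ v ≡ starHappy I v (lookup c′ v)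
  #happySpoke-uncoloured c′ v u = trans
    (#-cong (happySpoke? c′ v) (spoke? c v (lookup c′ v)) {edges} (All.tabulate (λ _ → mk⇔ proj₂ (u ,_))))
    (sym (starHappy≡#spoke v (lookup c′ v) u))

  -- Frees maximality from the restriction to candidates, as `c*` may use any colour: a colour with
  -- a positive star count occurs on a spoke and is thus a candidate.
  starHappy-maximal : ∀ {c₁} → FirstColouring I c₁ → ∀ v → Uncoloured I v → ∀ d →
                      starHappy I v d ≤ starHappy I v (lookup c₁ v)
  starHappy-maximal first v u d with starHappy I v d in eq
  ... | zero  = z≤n
  ... | suc m = subst (_≤ _) eq (FirstColouring.maximal first v u d (spoke⇒candidate
    (0<#⇒Any (spoke? c v d) edges (subst (0 <_) (trans (sym eq) (starHappy≡#spoke v d u)) (s≤s z≤n)))))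

  spokes≤spokes : ∀ {c* c₁} → FirstColouring I c₁ → ∀ v → #happySpoke c* v ≤ #happySpoke c₁ v
  spokes≤spokes {c*} {c₁} first v = go (≡-dec _≟_ (lookup c v) nothing)
    where
    open ≤-Reasoning
    go : Dec (Uncoloured I v) → #happySpoke c* v ≤ #happySpoke c₁ v
    -- A coloured vertex is the centre of no happy spoke under either colouring.
    go (no ¬u) = ≤-reflexive (#-cong (happySpoke? c* v) (happySpoke? c₁ v) {edges}
      (All.tabulate (λ _ → mk⇔ (⊥-elim ∘ ¬u ∘ proj₁) (⊥-elim ∘ ¬u ∘ proj₁))))
    go (yes u) = begin
      #happySpoke c* v                ≡⟨ #happySpoke-uncoloured c* v u ⟩
      starHappy I v (lookup c* v)     ≤⟨ starHappy-maximal first v u (lookup c* v) ⟩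
      starHappy I v (lookup c₁ v)     ≡⟨ #happySpoke-uncoloured c₁ v u ⟨
      #happySpoke c₁ v                ∎

  output-extends : ∀ {c′} → Output I c′ → Extends I c′
  output-extends (_ , _ , first , _ , inj₁ refl , _) = FirstColouring.extends first
  output-extends (_ , _ , _ , second , inj₂ refl , _) = SecondColouring.extends second

  approximation : ∀ {c* c′} → Extends I c* → Output I c′ → happy I c* ≤ 2 * happy I c′
  approximation {c*} {c′} ext* (c₁ , c₂ , first , second , _ , c₁≤c′ , c₂≤c′) = begin
    happy I c*                               ≤⟨ happy≤second+spokes {c*} {c₂} ext* second ⟩
    happy I c₂ + sum (#happySpoke c*)        ≤⟨ +-monoʳ-≤ (happy I c₂) (sum-mono (spokes≤spokes {c*} {c₁} first)) ⟩
    happy I c₂ + sum (#happySpoke c₁)        ≤⟨ +-monoʳ-≤ (happy I c₂) (spokes≤happy {c₁} (FirstColouring.extends first)) ⟩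
    happy I c₂ + happy I c₁                  ≤⟨ +-mono-≤ c₂≤c′ c₁≤c′ ⟩
    happy I c′ + happy I c′                  ≡⟨ cong (happy I c′ +_) (+-identityʳ _) ⟨
    2 * happy I c′                           ∎
    where open ≤-Reasoning

-- Correctness of the program

module _ (I : Instance) where
  open Instance I

  multiplicity : List (Colour I) → Colour I → ℕ
  multiplicity ds d = foldr (λ x acc → if does (x ≟ d) then suc acc else acc) 0 ds

  mode : Vertex I → Maybe (Colour I)
  mode v = foldr (pick (multiplicity (leaves c v edges))) nothing (leaves c v edges)

  MostFrequentLeaf : Vertex I → Colour I → Set
  MostFrequentLeaf v m = m ∈ leaves c v edges ×
    All (λ d → # (_≟ d) (leaves c v edges) ≤ # (_≟ m) (leaves c v edges)) (leaves c v edges)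

  -- The two outcomes of the program at an uncoloured vertex: the search ends in `nothing` only on
  -- an empty leaf list, where the default steps in.
  mode-or-default : ∀ a v → (leaves c v edges ≡ [] × fromMaybe a (mode v) ≡ a) ⊎
                            MostFrequentLeaf v (fromMaybe a (mode v))
  mode-or-default a v = go (mode v) (pick-maximises _ (leaves c v edges))
    where
    go : ∀ m → IsMaximiser (multiplicity (leaves c v edges)) (leaves c v edges) m →
         (leaves c v edges ≡ [] × fromMaybe a m ≡ a) ⊎ MostFrequentLeaf v (fromMaybe a m)
    go nothing  leafless   = inj₁ (leafless , refl)
    go (just m) (m∈ , max) = inj₂ (m∈ , All.map (λ {d} → subst₂ _≤_ (mult d) (mult m)) max)
      where
      mult : ∀ d → multiplicity (leaves c v edges) d ≡ # (_≟ d) (leaves c v edges)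
      mult d = #-foldr (_≟ d) (leaves c v edges)

  leafless⇒¬candidate : ∀ {v d} → leaves c v edges ≡ [] → ¬ Candidate I v d
  leafless⇒¬candidate leafless cand = ∉[] (subst (_ ∈_) leafless (candidate⇒leaf I cand))
    where
    ∉[] : ∀ {d : Colour I} → ¬ (d ∈ [])
    ∉[] ()

  -- The leaf colours at `v` are exactly its candidates and their frequencies are the star counts,
  -- so a most frequent leaf is a best candidate, and the leafless vertices are those without
  -- candidates.
  isFirstColouring : ∀ {c₁} a → Extends I c₁ → (∀ v → Uncoloured I v → lookup c₁ v ≡ fromMaybe a (mode v)) →
                     FirstColouring I c₁
  isFirstColouring {c₁} a ext c₁≡mode = record
    { extends   = ext
    ; candidate = λ v u (d , cand) → [ (λ (leafless , _) → ⊥-elim (leafless⇒¬candidate leafless cand))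
                                     , (λ (m∈ , _) → leaf⇒candidate I m∈) ]′ (choice v u)
    ; maximal   = λ v u d cand → [ (λ (leafless , _) → ⊥-elim (leafless⇒¬candidate leafless cand))
                                 , (λ (_ , max) → subst₂ _≤_ (frequency v u d) (frequency v u (lookup c₁ v))
                                                    (All.lookup max (candidate⇒leaf I cand))) ]′ (choice v u)
    ; remaining = a , λ v u ¬cand → [ proj₂
                                    , (λ (m∈ , _) → contradiction (_ , leaf⇒candidate I m∈) ¬cand) ]′ (choice v u)
    }
    where
    choice : ∀ v → Uncoloured I v → (leaves c v edges ≡ [] × lookup c₁ v ≡ a) ⊎ MostFrequentLeaf v (lookup c₁ v)
    choice v u = subst (λ m → (leaves c v edges ≡ [] × m ≡ a) ⊎ MostFrequentLeaf v m)
                       (sym (c₁≡mode v u)) (mode-or-default a v)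

    frequency : ∀ v → Uncoloured I v → ∀ d → # (_≟ d) (leaves c v edges) ≡ starHappy I v d
    frequency v u d = trans (#-leaves c v d (loopless I)) (sym (starHappy≡#spoke I v d u))

  -- The counts `h₁` and `h₂` stay abstract so that the case split is on the program's own
  -- comparison.
  better-output : ∀ {c₁ c₂} → FirstColouring I c₁ → SecondColouring I c₂ →
                  ∀ {h₁ h₂} → h₁ ≡ happy I c₁ → h₂ ≡ happy I c₂ →
                  Output I (if h₂ ≤ᵇ h₁ then c₁ else c₂)
  better-output first second {h₁} {h₂} h₁≡ h₂≡ with h₂ ≤ᵇ h₁ in eq
  ... | true  = _ , _ , first , second , inj₁ refl , ≤-refl , subst₂ _≤_ h₂≡ h₁≡ (≤ᵇ⇒≤ _ _ (subst T (sym eq) _))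
  ... | false = _ , _ , first , second , inj₂ refl ,
                subst₂ _≤_ h₁≡ h₂≡ (≰⇒≥ (λ h₂≤h₁ → subst T eq (≤⇒≤ᵇ h₂≤h₁))) , ≤-refl

-- The colourings and counts computed by the program

module _ (I : Instance) (a b : Colour I) where
  open Instance I
  open Semantics n k

  c₁ c₂ : Colouring I
  c₁ = value firstColouring (input I a b)
  c₂ = value secondColouring (c₁ ∷ input I a b)

  h₁ h₂ : ℕ
  h₁ = value {Γ = array colour ∷ array colour ∷ Inputs} (countHappy #2 #1) (c₂ ∷ c₁ ∷ input I a b)
  h₂ = value {Γ = array colour ∷ array colour ∷ Inputs} (countHappy #2 #0) (c₂ ∷ c₁ ∷ input I a b)

  -- Beyond looking up a tabulated entry this is pure computation: the program's inner loops
  -- evaluate to `leaves` and `mode`.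
  lookup-c₁ : ∀ v → lookup c₁ v ≡ maybe′ id (fromMaybe a (mode I v)) (lookup c v)
  lookup-c₁ v = lookup∘tabulate _ v

  lookup-c₂ : ∀ v → lookup c₂ v ≡ maybe′ id b (lookup c v)
  lookup-c₂ v = lookup∘tabulate _ v

  first : FirstColouring I c₁
  first = isFirstColouring I a
    (λ v d cv≡d → trans (lookup-c₁ v) (cong (maybe′ id (fromMaybe a (mode I v))) cv≡d))
    (λ v u → trans (lookup-c₁ v) (cong (maybe′ id (fromMaybe a (mode I v))) u))

  second : SecondColouring I c₂
  second = record
    { extends   = λ v d cv≡d → trans (lookup-c₂ v) (cong (maybe′ id b) cv≡d)
    ; remaining = b , λ v u → trans (lookup-c₂ v) (cong (maybe′ id b) u)
    }

  run-output : Output I (run I a b)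
  run-output = better-output I first second {h₁} {h₂} (#-foldr (happy? I c₁) edges) (#-foldr (happy? I c₂) edges)

-- Running time

if-≤ : ∀ {b x y m} → x ≤ m → y ≤ m → (if b then x else y) ≤ m
if-≤ {true}  x≤m y≤m = x≤m
if-≤ {false} x≤m y≤m = y≤m

maybe-≤ : ∀ {A : Set} {f : A → ℕ} {y m} o → (∀ x → f x ≤ m) → y ≤ m → maybe′ f y o ≤ m
maybe-≤ (just x) f≤m y≤m = f≤m x
maybe-≤ nothing  f≤m y≤m = y≤m

module Bounds (s : ℕ) where

  -- The successor keeps the base positive, so constants and lower powers are absorbed into bounds
  -- of the form `K * S ^ e`, which the lemmas below combine.
  S : ℕ
  S = suc s

  O-const : ∀ {x} K e → x ≤ K → x ≤ K * S ^ e
  O-const K e x≤K = ≤-trans x≤K (m≤m*n K (S ^ e) {{m^n≢0 S e}})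

  O-suc : ∀ {x} K e → x ≤ K * S ^ e → suc x ≤ suc K * S ^ e
  O-suc K e x≤ = +-mono-≤ (m^n>0 S e) x≤

  O-+ : ∀ {x y} K L e → x ≤ K * S ^ e → y ≤ L * S ^ e → x + y ≤ (K + L) * S ^ e
  O-+ K L e x≤ y≤ = ≤-trans (+-mono-≤ x≤ y≤) (≤-reflexive (sym (*-distribʳ-+ (S ^ e) K L)))

  O-lift : ∀ {x} K e → x ≤ K * S ^ e → x ≤ K * S ^ suc e
  O-lift K e x≤ = ≤-trans x≤ (*-monoʳ-≤ K (m≤n*m (S ^ e) S))

  O-* : ∀ {l x} K e → l ≤ S → x ≤ K * S ^ e → l * x ≤ K * S ^ suc e
  O-* {l} {x} K e l≤S x≤ = begin
    l * x              ≤⟨ *-mono-≤ l≤S x≤ ⟩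
    S * (K * S ^ e)    ≡⟨ *-assoc S K _ ⟨
    S * K * S ^ e      ≡⟨ cong (_* S ^ e) (*-comm S K) ⟩
    K * S * S ^ e      ≡⟨ *-assoc K S _ ⟩
    K * S ^ suc e      ∎
    where open ≤-Reasoning

  sum-≤ : ∀ {A : Set} {f : A → ℕ} {m} xs → (∀ x → f x ≤ m) → sumᴸ (map f xs) ≤ length xs * m
  sum-≤ []       f≤m = z≤n
  sum-≤ (x ∷ xs) f≤m = +-mono-≤ (f≤m x) (sum-≤ xs f≤m)

  module _ (n k : ℕ) where
    open Semantics n k

    foldTime-≤ : ∀ {A B : Set} {f : A → B → B} {cost : A → B → ℕ} {z m} xs →
                 (∀ x acc → cost x acc ≤ m) → foldTime f cost z xs ≤ length xs * suc m
    foldTime-≤         []       cost≤m = z≤n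
    foldTime-≤ {m = m} (x ∷ xs) cost≤m = ≤-trans
      (+-mono-≤ (foldTime-≤ xs cost≤m) (s≤s (cost≤m x _))) (≤-reflexive (+-comm (length xs * suc m) (suc m)))

    -- The step paid per iteration turns `K` into `suc K`; at most `S` iterations raise the exponent
    -- by one.
    O-foldTime : ∀ {A B : Set} {f : A → B → B} {cost : A → B → ℕ} {z} K e xs → length xs ≤ S →
                 (∀ x acc → cost x acc ≤ K * S ^ e) → foldTime f cost z xs ≤ suc K * S ^ suc e
    O-foldTime K e xs short cost≤ = ≤-trans (foldTime-≤ xs cost≤) (O-* (suc K) e short (O-suc K e ≤-refl))

    -- Here `f` already includes the step paid per iteration, so the constant stays `K`.
    O-forVertex : ∀ {f : Fin n → ℕ} K e → n ≤ S → (∀ v → f v ≤ K * S ^ e) →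
                  sumᴸ (map f (allFin n)) ≤ K * S ^ suc e
    O-forVertex K e n≤S f≤ = ≤-trans (sum-≤ (allFin n) f≤)
      (≤-trans (≤-reflexive (cong (_* (K * S ^ e)) (length-tabulate {n = n} id))) (O-* K e n≤S ≤-refl))

    time-count : ∀ {Γ} (d : colour ∈ Γ) (ds : list colour ∈ Γ) (ρ : Env Γ) →
                 length (All.lookup ρ ds) ≤ S → time (count d ds) ρ ≤ 10 * S ^ 1
    time-count d ds ρ short =
      -- Three steps for the fold, its list and its initial value; then at most six for the body and
      -- one more per iteration.
      O-+ 3 7 1 (O-const 3 1 ≤-refl)
        (O-foldTime 6 0 (All.lookup ρ ds) short λ x acc →
          O-const 6 0 (+-monoʳ-≤ 4 (if-≤ ≤-refl (m≤m+n 1 1))))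

    time-countHappy : ∀ {Γ} (es : list edge ∈ Γ) (c′ : array colour ∈ Γ) (ρ : Env Γ) →
                      length (All.lookup ρ es) ≤ S → time (countHappy es c′) ρ ≤ 16 * S ^ 1
    time-countHappy es c′ ρ short =
      O-+ 3 13 1 (O-const 3 1 ≤-refl)
        (O-foldTime 12 0 (All.lookup ρ es) short λ x acc →
          O-const 12 0 (+-monoʳ-≤ 10 (if-≤ ≤-refl (m≤m+n 1 1))))

    time-leafColours : ∀ {Γ} (es : list edge ∈ Γ) (c : array (option colour) ∈ Γ) (v : vertex ∈ Γ) (ρ : Env Γ) →
                       length (All.lookup ρ es) ≤ S → time (leafColours es c v) ρ ≤ 22 * S ^ 1
    time-leafColours es c v ρ short =
      O-+ 3 19 1 (O-const 3 1 ≤-refl)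
        (O-foldTime 18 0 (All.lookup ρ es) short λ x acc →
          O-const 18 0 (+-monoʳ-≤ 5 (if-≤
            -- Testing the second endpoint costs five steps before its own case distinction of at
            -- most eight, so 13 covers both branches.
            (≤-trans (caseOpt-≤ (lookup (All.lookup ρ c) (proj₂ x))) (m≤m+n 8 5))
            (+-monoʳ-≤ 5 (if-≤ (caseOpt-≤ (lookup (All.lookup ρ c) (proj₁ x))) (m≤m+n 1 7))))))
      where
      caseOpt-≤ : ∀ {A : Set} (o : Maybe A) → 5 + maybe′ (λ _ → 3) 1 o ≤ 8
      caseOpt-≤ o = +-monoʳ-≤ 5 (maybe-≤ o (λ _ → ≤-refl) (m≤m+n 1 2))

    time-mostFrequent : ∀ {Γ} (ds : list colour ∈ Γ) (ρ : Env Γ) →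
                        length (All.lookup ρ ds) ≤ S → time (mostFrequent ds) ρ ≤ 30 * S ^ 2
    time-mostFrequent {Γ} ds ρ short =
      -- Each iteration counts two multiplicities over the whole list, each at cost `10 * S ^ 1`;
      -- hence the square.
      O-+ 3 27 2 (O-const 3 2 ≤-refl)
        (O-foldTime 26 1 (All.lookup ρ ds) short λ x acc →
          O-suc 25 1 (O-suc 24 1 (maybe-≤ acc
            (λ m → O-suc 23 1 (O-suc 22 1 (O-+ 20 2 1
              (O-+ 10 10 1 (count-≤ #1 (m ∷ x ∷ acc ∷ ρ) short) (count-≤ #0 (m ∷ x ∷ acc ∷ ρ) short))
              (O-const 2 1 (if-≤ ≤-refl ≤-refl)))))
            (O-const 24 1 (m≤m+n 2 22)))))
      where
      count-≤ : (d : colour ∈ colour ∷ colour ∷ option colour ∷ Γ) (ρ′ : Env (colour ∷ colour ∷ option colour ∷ Γ)) →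
                length (All.lookup ρ′ (there (there (there ds)))) ≤ S →
                time (count d (there (there (there ds)))) ρ′ ≤ 10 * S ^ 1
      count-≤ d = time-count d (there (there (there ds)))

module _ (I : Instance) (a b : Colour I) where
  open Instance I
  open Semantics n k
  open Bounds (size I)

  edges-short : length edges ≤ S
  edges-short = m≤n⇒m≤1+n (m≤n+m (length edges) n)

  n≤S : n ≤ S
  n≤S = m≤n⇒m≤1+n (m≤m+n n (length edges))

  time-firstColouring : time firstColouring (input I a b) ≤ 61 * S ^ 3
  time-firstColouring =
    O-suc 60 3 (O-forVertex n k 60 2 n≤S λ v →
      -- Five steps go to the iteration, the case distinction and the array lookup. The quadratic
      -- search for a most frequent leaf, done for every vertex, makes the total cubic.
      O-+ 5 55 2 (O-const 5 2 ≤-refl) (maybe-≤ (lookup c v)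
        (λ _ → O-const 55 2 (m≤m+n 1 54))
        (O-suc 54 2 (O-+ 22 32 2
          (O-lift 22 1 (time-leafColours n k {vertex ∷ Inputs} #1 #2 #0 (v ∷ input I a b) edges-short))
          (O-suc 31 2 (O-+ 30 1 2
            (time-mostFrequent n k {list colour ∷ vertex ∷ Inputs} #0 (leaves c v edges ∷ v ∷ input I a b)
              (≤-trans (length-leaves c v edges) edges-short))
            (O-const 1 2 (maybe-≤ (mode I v) (λ _ → ≤-refl) ≤-refl))))))))

  time-secondColouring : time secondColouring (c₁ I a b ∷ input I a b) ≤ 7 * S ^ 1
  time-secondColouring =
    O-suc 6 1 (O-forVertex n k 6 0 n≤S λ v →
      O-const 6 0 (+-monoʳ-≤ 5 (maybe-≤ (lookup c v) (λ _ → ≤-refl) ≤-refl)))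

  runningTime-≤ : runningTime I a b ≤ 105 * S ^ 3
  runningTime-≤ =
    O-suc 104 3 (O-+ 61 43 3 time-firstColouring
      (O-suc 42 3 (O-+ 7 35 3 (O-lift 7 2 (O-lift 7 1 time-secondColouring))
        (O-suc 34 3 (O-suc 33 3 (O-+ 32 1 3
          (O-lift 32 2 (O-lift 32 1 (O-+ 16 16 1
            (countHappy-≤ #0) (countHappy-≤ #1))))
          (O-const 1 3 (if-≤ {h₂ I a b ≤ᵇ h₁ I a b} ≤-refl ≤-refl))))))))
    where
    ρ : Env (array colour ∷ array colour ∷ Inputs)
    ρ = c₂ I a b ∷ c₁ I a b ∷ input I a b
    countHappy-≤ : ∀ c′ → time (countHappy #2 c′) ρ ≤ 16 * S ^ 1
    countHappy-≤ c′ = time-countHappy n k #2 c′ ρ edges-short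

theorem3p2 : (∃[ K ] ∃[ e ] ((I : Instance) (a b : Colour I) →
    Output I (run I a b) × runningTime I a b ≤ K * suc (size I) ^ e))
    ×
    ((I : Instance) → ∃[ opt ] (IsOPT I opt ×
    ((c′ : Colouring I) → Output I c′ → Extends I c′ × opt ≤ 2 * happy I c′)))
theorem3p2 =
  (105 , 3 , λ I a b → run-output I a b , runningTime-≤ I a b) ,
  λ I → let opt , isOPT@((c* , ext* , happy≡opt) , _) = optimum I in
    opt , isOPT , λ c′ out →
      output-extends I {c′} out , subst (_≤ 2 * happy I c′) happy≡opt (approximation I {c*} {c′} ext* out)
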